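{- Conditional belief cannot be defined in terms of knowledge and safe belief: for every agent $i \in G$, the conditional belief operator $B_i^{(\cdot)}(\cdot)$ is not definable in the language $\mathcal{L}(K,B^+)$ over the class of all epistemic plausibility models.
   Context: Fix a non-empty set $G$ of agents and a countably infinite set $Prop$ of proposition letters. Models. An epistemic plausibility model is a structure $\mathbb{M} = \langle W, \{\sim_i\}_{i \in G}, \{\leq_{i,w}\}_{i \in G}^{w \in W}, V\rangle$ where $W$ is a non-empty set of states, each $\sim_i \subseteq W\times W$ is an equivalence relation, each $\leq_{i,w} \subseteq W \times W$ is a well-founded pre-order, and $V : Prop \to \wp(W)$. For $X \subseteq W$, $\mathrm{Min}_{\leq_{i,w}}(X) := \{x \in X \mid \forall y \in X: y \leq_{i,w} x \Rightarrow x \leq_{i,w} y\}$. A well-founded pre-order is a reflexive transitive relation (not necessarily total) such that $\mathrm{Min}_{\leq_{i,w}}(X) \neq \emptyset$ for every non-empty $X \subseteq W$. Write $[w]_{\sim_i} := \{v \in W \mid w \sim_i v\}$. Language and semantics. $\mathcal{L}(K,B^+)$ is built from proposition letters $p\in Prop$ using $\neg$, $\wedge$ and the unary operators $K_i$ (knowledge) and $B_i^+$ (safe belief), $i\in G$. Proposition letters (via $V$) and Booleans are interpreted as usual; $[\![\alpha]\!]^{\mathbb{M}} := \{w \in W \mid \mathbb{M},w\models\alpha\}$; $\mathbb{M},w \models K_i\varphi$ iff $\forall v \in [w]_{\sim_i}: \mathbb{M},v\models\varphi$; $\mathbb{M},w \models B_i^+\varphi$ iff $\forall v \in [w]_{\sim_i}: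 v \leq_{i,w} w \Rightarrow \mathbb{M},v\models\varphi$; and conditional belief is interpreted by $\mathbb{M},w \models B_i^\alpha\varphi$ iff $\forall v \in \mathrm{Min}_{\leq_{i,w}}([\![\alpha]\!]^{\mathbb{M}} \cap [w]_{\sim_i}): \mathbb{M},v\models\varphi$. Definability. The operator $B_i^{(\cdot)}(\cdot)$ is definable in $\mathcal{L}(K,B^+)$ if for all $\alpha,\beta\in\mathcal{L}(K,B^+)$ there is a formula $\varphi\in\mathcal{L}(K,B^+)$ such that $\mathbb{M},w\models B_i^\alpha\beta\leftrightarrow\varphi$ for all epistemic plausibility models $\mathbb{M}$ and all states $w$ of $\mathbb{M}$. -}

module Defs where

open import Data.Product using (_×_; ∃-syntax)
open import Function.Bundles using (_⇔_)
open import Level using (0ℓ)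
open import Relation.Binary.Core using (Rel)
open import Relation.Binary.PropositionalEquality using (_≡_)
open import Relation.Binary.Structures using (IsEquivalence; IsPreorder)
open import Relation.Nullary using (¬_)
open import Relation.Unary using (Pred; _∈_; _∩_; Empty)

-- X ≠ ∅, read negatively. With the positive reading (a given element of X),
-- well-foundedness below would decide arbitrary propositions as soon as two
-- distinct states are comparable; classically the two readings agree.
NonEmpty : {W : Set} → Pred W 0ℓ → Set
NonEmpty X = ¬ Empty X

Min : {W : Set} → Rel W 0ℓ → Pred W 0ℓ → Pred W 0ℓ
Min _≤_ X x = x ∈ X × (∀ y → y ∈ X → y ≤ x → x ≤ y)

-- Well-foundedness here is existence of minimal elements, for a pre-order that
-- need be neither total nor antisymmetric; it is not the accessibility-based
-- notion of Induction.WellFounded.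
record IsWellFoundedPreorder {W : Set} (_≤_ : Rel W 0ℓ) : Set₁ where
  field
    isPreorder   : IsPreorder _≡_ _≤_
    Min-nonEmpty : (X : Pred W 0ℓ) → NonEmpty X → NonEmpty (Min _≤_ X)

module Logic (G Atom : Set) where

  record Model : Set₁ where
    field
      W               : Set
      inhabitant      : W
      _∼[_]_          : W → G → W → Set
      ∼-isEquivalence : ∀ i → IsEquivalence (λ w v → w ∼[ i ] v)
      ≤[_,_]          : G → W → Rel W 0ℓ
      ≤-isWFPreorder  : ∀ i w → IsWellFoundedPreorder ≤[ i , w ]
      V               : Atom → Pred W 0ℓ

    [_]∼ : W → G → Pred W 0ℓ
    [ w ]∼ i v = w ∼[ i ] v

  data Formula : Set where
    atom : Atom → Formula
    ¬̇_   : Formula → Formula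
    _∧̇_  : Formula → Formula → Formula
    K    : G → Formula → Formula
    B⁺   : G → Formula → Formula

  infix 4 _,_⊨_

  _,_⊨_ : (M : Model) → Model.W M → Formula → Set
  M , w ⊨ atom p  = w ∈ Model.V M p
  M , w ⊨ (¬̇ φ)   = ¬ (M , w ⊨ φ)
  M , w ⊨ (φ ∧̇ ψ) = (M , w ⊨ φ) × (M , w ⊨ ψ)
  M , w ⊨ K i φ   = ∀ v → v ∈ Model.[_]∼ M w i → M , v ⊨ φ
  M , w ⊨ B⁺ i φ  =
    ∀ v → v ∈ Model.[_]∼ M w i → Model.≤[_,_] M i w v w → M , v ⊨ φ

  ⟦_⟧ : Formula → (M : Model) → Pred (Model.W M) 0ℓ
  ⟦ α ⟧ M w = M , w ⊨ α

  -- M , w ⊨B[ i , α ] β is the satisfaction clause for "B_i^α β".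
  _,_⊨B[_,_]_ : (M : Model) → Model.W M → G → Formula → Formula → Set
  M , w ⊨B[ i , α ] β =
    ∀ v → v ∈ Min (Model.≤[_,_] M i w) (⟦ α ⟧ M ∩ Model.[_]∼ M w i) → M , v ⊨ β

  ConditionalBeliefDefinable : G → Set₁
  ConditionalBeliefDefinable i =
    ∀ (α β : Formula) → ∃[ φ ] (∀ (M : Model) (w : Model.W M) →
      (M , w ⊨B[ i , α ] β) ⇔ (M , w ⊨ φ))

{-# OPTIONS --safe #-}
-- Safe belief at w only looks at the states below w in the order attached to w,
-- so changing how ≤_{i,w} relates w to the states that are not below it changes
-- no formula of L(K,B⁺). On the two states true and false, all indistinguishable
-- and with every letter p true exactly at true, compare the discrete order with
-- the order in which w is strictly below every other state. In both, w is the
-- only state below w, yet B^⊤ p holds at true for the second order only.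
module Submission where

open import Defs
open import Data.Bool using (Bool; true; false; T)
open import Data.Empty using (⊥-elim)
open import Data.Nat using (ℕ; zero)
open import Data.Product using (_,_; proj₁; map)
open import Data.Sum using (_⊎_; inj₁; inj₂; [_,_]′)
open import Data.Unit using (⊤; tt)
open import Function using (id; _∘_)
open import Function.Bundles using (_⤖_; _⇔_; mk⇔; module Equivalence; module Bijection)
open import Level using (0ℓ)
open import Relation.Binary.Core using (Rel)
open import Relation.Binary.PropositionalEquality
  using (_≡_; refl; sym; trans; isEquivalence; subst)
open import Relation.Binary.Structures using (IsPreorder)
open import Relation.Nullary using (¬_)
open import Relation.Unary using (Pred; _∉_; Empty)

≡-isWFPreorder : {W : Set} → IsWellFoundedPreorder {W} _≡_
≡-isWFPreorder = record
  { isPreorder   = record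
    { isEquivalence = isEquivalence ; reflexive = id ; trans = trans }
  ; Min-nonEmpty = λ X X≢∅ Min≡∅ →
      X≢∅ λ x x∈X → Min≡∅ x (x∈X , λ _ _ → sym)
  }

Centred : {W : Set} → W → Rel W 0ℓ
Centred w v u = v ≡ u ⊎ v ≡ w

Centred-isPreorder : {W : Set} (w : W) → IsPreorder _≡_ (Centred w)
Centred-isPreorder w = record
  { isEquivalence = isEquivalence
  ; reflexive     = inj₁
  ; trans         = λ { (inj₁ refl) q → q
                      ; (inj₂ p) _ → inj₂ p }
  }

-- If `w` lies in `X`, it is minimal there; otherwise the order restricted to `X` is discrete and
-- every element is minimal. Assuming `Min` empty refutes the first case, so membership of `w` need
-- not be decided.
Centred-isWFPreorder : {W : Set} (w : W) → IsWellFoundedPreorder (Centred w)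
Centred-isWFPreorder w = record
  { isPreorder   = Centred-isPreorder w
  ; Min-nonEmpty = λ X X≢∅ Min≡∅ → X≢∅ (empty X Min≡∅)
  }
  where
  module _ (X : Pred _ 0ℓ) (Min≡∅ : Empty (Min (Centred w) X)) where
    w∉X : w ∉ X
    w∉X w∈X = Min≡∅ w (w∈X , λ _ _ _ → inj₂ refl)

    empty : Empty X
    empty x x∈X = Min≡∅ x (x∈X , λ y y∈X →
      [ inj₁ ∘ sym , (λ y≡w → ⊥-elim (w∉X (subst X y≡w y∈X))) ]′)

module _ {G Atom : Set} where
  open Logic G Atom
  open Model
  open Equivalence

  reorder : (M : Model) (_≼[_,_]_ : W M → G → W M → W M → Set) →
            (∀ i w → IsWellFoundedPreorder (λ v u → v ≼[ i , w ] u)) → Model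
  reorder M _≼[_,_]_ wf = record M
    { ≤[_,_]         = λ i w v u → v ≼[ i , w ] u
    ; ≤-isWFPreorder = wf
    }

  -- Induction on `φ`, where only the `B⁺` clause consults the order. Negation swaps the two
  -- directions, so both are carried along together.
  ⊨-reorder : ∀ M {_≼[_,_]_} wf →
    (∀ i w v → ≤[_,_] M i w v w ⇔ (v ≼[ i , w ] w)) →
    ∀ φ w → (M , w ⊨ φ) ⇔ (reorder M _≼[_,_]_ wf , w ⊨ φ)
  ⊨-reorder M wf below = go
    where
    go : ∀ φ w → (M , w ⊨ φ) ⇔ (reorder M _ wf , w ⊨ φ)
    go (atom p) w = mk⇔ id id
    go (¬̇ φ)    w = mk⇔ (_∘ from (go φ w)) (_∘ to (go φ w))
    go (φ ∧̇ ψ)  w = mk⇔ (map (to (go φ w)) (to (go ψ w)))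
                        (map (from (go φ w)) (from (go ψ w)))
    go (K i φ)  w = mk⇔ (λ h v r → to (go φ v) (h v r))
                        (λ h v r → from (go φ v) (h v r))
    go (B⁺ i φ) w = mk⇔
      (λ h v r v≼w → to (go φ v) (h v r (from (below i w v) v≼w)))
      (λ h v r v≤w → from (go φ v) (h v r (to (below i w v) v≤w)))

  discrete : Model
  discrete = record
    { W               = Bool
    ; inhabitant      = true
    ; _∼[_]_          = λ _ _ _ → ⊤
    ; ∼-isEquivalence = λ _ → _
    ; ≤[_,_]          = λ _ _ → _≡_
    ; ≤-isWFPreorder  = λ _ _ → ≡-isWFPreorder
    ; V               = λ _ → T
    }

  centred : Model
  centred = reorder discrete (λ v _ w u → Centred w v u)
                    (λ _ → Centred-isWFPreorder)

  discrete⇔centred : ∀ φ w → (discrete , w ⊨ φ) ⇔ (centred , w ⊨ φ)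
  discrete⇔centred = ⊨-reorder discrete (λ _ → Centred-isWFPreorder)
    -- At `u = w` both disjuncts of `Centred w v u` read `v ≡ w`.
    λ _ _ _ → mk⇔ inj₁ [ id , id ]′

  -- Non-contradiction serves as the tautology because it holds constructively at every state.
  ⊤̇ : Atom → Formula
  ⊤̇ p = ¬̇ (p̂ ∧̇ (¬̇ p̂))
    where p̂ = atom p

  ⊨⊤̇ : ∀ M w p → M , w ⊨ ⊤̇ p
  ⊨⊤̇ M w p (h , ¬h) = ¬h h

  centred⊨B : ∀ i p → centred , true ⊨B[ i , ⊤̇ p ] atom p
  centred⊨B i p true  _         = tt
  -- Since `true` is below `false`, minimality of `false` would put `false` below `true`, forcing
  -- `false ≡ true`.
  centred⊨B i p false (_ , min) with min true (⊨⊤̇ centred true p , tt) (inj₂ refl)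
  ... | inj₁ ()
  ... | inj₂ ()

  -- Under the discrete order every state is minimal, including `false`, where `p` fails.
  discrete⊭B : ∀ i p → ¬ (discrete , true ⊨B[ i , ⊤̇ p ] atom p)
  discrete⊭B i p h = h false ((⊨⊤̇ discrete false p , tt) , λ _ _ → sym)

  ¬definable : Atom → ∀ i → ¬ ConditionalBeliefDefinable i
  ¬definable p i definable with definable (⊤̇ p) (atom p)
  ... | φ , B⇔φ = discrete⊭B i p
    (from (B⇔φ discrete true)
      (from (discrete⇔centred φ true)
        (to (B⇔φ centred true) (centred⊨B i p))))

theorem14 : (G Prp : Set) → G → Prp ⤖ ℕ →
    (i : G) → ¬ Logic.ConditionalBeliefDefinable G Prp i
-- The letter `p` is the preimage of `zero`.
theorem14 G Prp _ Prp⤖ℕ = ¬definable (proj₁ (Bijection.surjective Prp⤖ℕ zero))
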